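{- Let $P(\vec\alpha,\vec\beta,\vec\xi)\in\mathcal{P}$ be a syntactically compositional predicate and $P'(\vec\alpha,\vec\xi)\in\mathcal{P}$ a predicate which is a completion of $P$ with respect to a pair of constants $\vec c=(c_1,c_2)$. Then $P'(\vec\alpha,\vec\xi)\Leftrightarrow P(\vec\alpha,\vec c,\vec\xi)$ holds, and the entailment $\exists\vec\beta.\ P(\vec\alpha,\vec\beta,\vec\xi)\ast P'(\vec\beta,\vec\xi)\Rightarrow P'(\vec\alpha,\vec\xi)$ holds.
   Context: Separation logic setting: location variables (interpreted in a set $\mathbb{L}$ of locations, with a constant ${\sf nil}$) and data variables; pointer fields $\mathcal{F}$ and data fields $\mathcal{D}$. A state is $(s,h)$ with $s$ a stack assigning values to variables and $h$ a finite partial heap mapping (location, field) pairs to locations or data values. Formulas: pure parts (location (dis)equalities and data constraints in a decidable theory), spatial parts $\mathtt{emp}$, $E\mapsto\rho$, predicate atoms, $\ast$ (separating conjunction over domain-disjoint heaps), with $\land,\lor,\exists$. Predicates are defined by finite sets of rules $Q(E,\vec F)::=\exists\vec Z.\Pi\land\Sigma$ with least-fixed-point semantics; an entailment $A\Rightarrow B$ means every $(s,h)$ satisfying $A$ satisfies $B$; $\Leftrightarrow$ means entailment in both directions. Syntactic compositionality: $P$ has parameters $(\vec\alpha,\vec\beta,\vec\xi)$, $\vec\alpha=(E,C)$ (source), $\vec\beta=(F,H)$ (hole), $E,F$ location variables, $C,H$ data variables, $\vec\xi$ static parameters. $P$ is syntactically compositional if it has exactly one base rule $P(\vec\alpha,\vec\beta,\vec\xi)::=\alpha_1=\beta_1\land\alpha_2=\beta_2\land\mathtt{emp}$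 and at least one inductive rule, every inductive rule being of the form $P(\vec\alpha,\vec\beta,\vec\xi)::=\exists\vec Z.\ \Pi\land\Sigma_1\ast\Sigma_2\ast P(\vec\gamma,\vec\beta,\vec\xi)$ where $\Sigma_1$ is a nonempty separating conjunction of points-to atoms containing a unique points-to atom from $E$ and all location variables of $\vec Z$, whose Gaifman graph is a connected DAG rooted at $E$; $\Sigma_2$ is a possibly empty separating conjunction of predicate atoms whose first arguments are sink vertices of that graph; $\vec\gamma$ consists of variables of $\vec Z$; and the variables of $\vec\beta$ do not occur in $\Pi,\Sigma_1,\Sigma_2,\vec\gamma$. Completion: $P'$ with parameters $(\vec\alpha,\vec\xi)$ is a completion of $P$ with respect to $\vec c=(c_1,c_2)$ if its rules are obtained from those of $P$ by the substitution $\beta_1\mapsto c_1,\beta_2\mapsto c_2$: its only base rule is $P'(\vec\alpha,\vec\xi)::=\alpha_1=c_1\land\alpha_2=c_2\land\mathtt{emp}$, and for each inductive rule $P(\vec\alpha,\vec\beta,\vec\xi)::=\exists\vec Z.\ \Pi\land\Sigma_1\ast\Sigma_2\ast P(\vec\gamma,\vec\beta,\vec\xi)$ of $P$, $P'$ has the inductive rule $P'(\vec\alpha,\vec\xi)::=\exists\vec Z.\ \Pi\land\Sigma_1\ast\Sigma_2\ast P'(\vec\gamma,\vec\xi)$ (and these are all its rules). -}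

module Defs where

open import Data.List.Base using (List; []; _∷_; _++_)
open import Data.List.Membership.Propositional using (_∈_)
open import Data.List.Membership.Propositional.Properties using (∈-++⁺ˡ; ∈-++⁺ʳ)
open import Data.List.Relation.Unary.All as All using (All; []; _∷_)
open import Data.List.Relation.Unary.All.Properties using (++⁺)
open import Data.List.Relation.Unary.Any using (here; there)
open import Data.Maybe using (Maybe; just; nothing; Is-just; _<∣>_)
open import Data.Nat.Base using (ℕ)
open import Data.Product.Base using (_×_; _,_; ∃; ∃-syntax; Σ-syntax)
open import Data.Sum.Base using (_⊎_)
open import Data.Vec.Base as Vec using (Vec)
open import Function.Base using (_∘_)
open import Function.Bundles using (_⇔_)
open import Relation.Binary.Construct.Closure.ReflexiveTransitive using (Star)
open import Relation.Binary.Construct.Closure.Transitive using (TransClosure)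
open import Relation.Binary.PropositionalEquality using (_≡_; _≢_; refl)
open import Relation.Nullary using (¬_; Dec)

data Sort : Set where
  loc dat : Sort

-- Formulas are well-scoped and well-sorted: a context lists the sorts of the
-- variables in scope, and a variable of sort σ is a proof of σ ∈ Γ.
Ctx : Set
Ctx = List Sort

bySort : Set → Set → Sort → Set
bySort L D loc = L
bySort L D dat = D

record Signature : Set₁ where
  field
    Loc Data : Set

  Val : Sort → Set
  Val = bySort Loc Data

  field
    -- Field loc are the pointer fields, Field dat the data fields.
    Field : Sort → Set

    Const   : Sort → Set
    ⟦_⟧ᶜ    : ∀ {σ} → Const σ → Val σ
    nil     : Const loc

    -- The data theory: Constraint n are its formulas with n free variables.
    Constraint   : ℕ → Set
    Holds        : ∀ {n} → Constraint n → Vec Data n → Set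
    satisfiable? : ∀ {n} (φ : Constraint n) → Dec (∃[ ds ] Holds φ ds)

    -- Predicate symbols, indexed by the sorts of their parameters.
    Pred : Ctx → Set

open Signature ⦃ ... ⦄ public

pattern ₀ = here refl
pattern ₁ = there (here refl)
pattern ₂ = there (there (here refl))
pattern ₃ = there (there (there (here refl)))

module _ ⦃ S : Signature ⦄ where

  data Term (Γ : Ctx) : Sort → Set where
    var   : ∀ {σ} → σ ∈ Γ → Term Γ σ
    const : ∀ {σ} → Const σ → Term Γ σ

  -- Tuples of terms of sorts Δ. They serve both as argument tuples of
  -- predicates and as simultaneous substitutions from Δ to Γ.
  Terms : Ctx → Ctx → Set
  Terms Γ Δ = All (Term Γ) Δ

  vars : ∀ {Γ Δ} → (∀ {σ} → σ ∈ Δ → σ ∈ Γ) → Terms Γ Δ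
  vars f = All.tabulate (var ∘ f)

  infix  8 _≐_ _≠ₗ_
  infixr 7 _∧ᵖ_

  data Pure (Γ : Ctx) : Set where
    _≐_   : ∀ {σ} → Term Γ σ → Term Γ σ → Pure Γ
    _≠ₗ_  : Term Γ loc → Term Γ loc → Pure Γ
    data⟨_⟩ : ∀ {n} → Constraint n → Vec (Term Γ dat) n → Pure Γ
    _∧ᵖ_  : Pure Γ → Pure Γ → Pure Γ

  -- The right-hand side ρ of a points-to atom: a finite set of fields paired
  -- with terms of the sort of the field.
  Record : Ctx → Set
  Record Γ = List (∃[ σ ] Field σ × Term Γ σ)

  infix  8 _↦_
  infixr 7 _∗_

  data Spatial (Γ : Ctx) : Set where
    emp  : Spatial Γ
    _↦_  : Term Γ loc → Record Γ → Spatial Γ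
    pred : ∀ {Δ} → Pred (loc ∷ Δ) → Terms Γ (loc ∷ Δ) → Spatial Γ
    _∗_  : Spatial Γ → Spatial Γ → Spatial Γ

  infixr 6 _∧_
  infixr 5 _∨_

  data Formula (Γ : Ctx) : Set where
    pure    : Pure Γ → Formula Γ
    spatial : Spatial Γ → Formula Γ
    _∧_ _∨_ : Formula Γ → Formula Γ → Formula Γ
    exists  : ∀ Z → Formula (Z ++ Γ) → Formula Γ

  -- The right-hand side ∃Z. Π ∧ Σ of a rule for a predicate with parameters Γ;
  -- the bound variables come first in the context.
  infix 4 ∃⟨_⟩_∧_

  record Rule (Γ : Ctx) : Set where
    constructor ∃⟨_⟩_∧_
    field
      bound   : Ctx
      pureᴿ   : Pure (bound ++ Γ)
      spatialᴿ : Spatial (bound ++ Γ)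

  -- The list is read as a finite set: order and repetitions are irrelevant.
  record Definitions : Set where
    field
      rules : ∀ {Γ} → Pred Γ → List (Rule Γ)

  open Definitions ⦃ ... ⦄ public

  substᵗ : ∀ {Γ Δ σ} → Terms Γ Δ → Term Δ σ → Term Γ σ
  substᵗ θ (var x)   = All.lookup θ x
  substᵗ θ (const c) = const c

  substˢ : ∀ {Γ Δ Ξ} → Terms Γ Δ → Terms Δ Ξ → Terms Γ Ξ
  substˢ θ = All.map (substᵗ θ)

  substᴾ : ∀ {Γ Δ} → Terms Γ Δ → Pure Δ → Pure Γ
  substᴾ θ (t ≐ u)        = substᵗ θ t ≐ substᵗ θ u
  substᴾ θ (t ≠ₗ u)       = substᵗ θ t ≠ₗ substᵗ θ u
  substᴾ θ (data⟨ φ ⟩ ts) = data⟨ φ ⟩ (Vec.map (substᵗ θ) ts)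
  substᴾ θ (Π₁ ∧ᵖ Π₂)     = substᴾ θ Π₁ ∧ᵖ substᴾ θ Π₂

  substᴿ : ∀ {Γ Δ} → Terms Γ Δ → Record Δ → Record Γ
  substᴿ θ []                = []
  substᴿ θ ((σ , f , t) ∷ ρ) = (σ , f , substᵗ θ t) ∷ substᴿ θ ρ

  substΣ : ∀ {Γ Δ} → Terms Γ Δ → Spatial Δ → Spatial Γ
  substΣ θ emp         = emp
  substΣ θ (t ↦ ρ)     = substᵗ θ t ↦ substᴿ θ ρ
  substΣ θ (pred Q ts) = pred Q (substˢ θ ts)
  substΣ θ (Σ₁ ∗ Σ₂)   = substΣ θ Σ₁ ∗ substΣ θ Σ₂

  data _∈ᵗ_ {Γ σ} (x : σ ∈ Γ) : ∀ {τ} → Term Γ τ → Set where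
    var : x ∈ᵗ var x

  data _∈ᵛ_ {Γ σ} (x : σ ∈ Γ) : ∀ {n} → Vec (Term Γ dat) n → Set where
    head : ∀ {n t} {ts : Vec _ n} → x ∈ᵗ t  → x ∈ᵛ (t Vec.∷ ts)
    tail : ∀ {n t} {ts : Vec _ n} → x ∈ᵛ ts → x ∈ᵛ (t Vec.∷ ts)

  data _∈ˢ_ {Γ σ} (x : σ ∈ Γ) : ∀ {Δ} → Terms Γ Δ → Set where
    head : ∀ {τ Δ} {t : Term Γ τ} {ts : Terms Γ Δ} → x ∈ᵗ t  → x ∈ˢ (t ∷ ts)
    tail : ∀ {τ Δ} {t : Term Γ τ} {ts : Terms Γ Δ} → x ∈ˢ ts → x ∈ˢ (t ∷ ts)

  data _∈ᴾ_ {Γ σ} (x : σ ∈ Γ) : Pure Γ → Set where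
    ≐ˡ    : ∀ {τ} {t u : Term Γ τ} → x ∈ᵗ t → x ∈ᴾ (t ≐ u)
    ≐ʳ    : ∀ {τ} {t u : Term Γ τ} → x ∈ᵗ u → x ∈ᴾ (t ≐ u)
    ≠ˡ    : ∀ {t u} → x ∈ᵗ t → x ∈ᴾ (t ≠ₗ u)
    ≠ʳ    : ∀ {t u} → x ∈ᵗ u → x ∈ᴾ (t ≠ₗ u)
    data⟨⟩ : ∀ {n ts} {φ : Constraint n} → x ∈ᵛ ts → x ∈ᴾ (data⟨ φ ⟩ ts)
    ∧ˡ    : ∀ {Π₁ Π₂} → x ∈ᴾ Π₁ → x ∈ᴾ (Π₁ ∧ᵖ Π₂)
    ∧ʳ    : ∀ {Π₁ Π₂} → x ∈ᴾ Π₂ → x ∈ᴾ (Π₁ ∧ᵖ Π₂)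

  data _∈Σ_ {Γ σ} (x : σ ∈ Γ) : Spatial Γ → Set where
    source : ∀ {t ρ} → x ∈ᵗ t → x ∈Σ (t ↦ ρ)
    target : ∀ {t ρ τ} {f : Field τ} {u} →
             (τ , f , u) ∈ ρ → x ∈ᵗ u → x ∈Σ (t ↦ ρ)
    arg    : ∀ {Δ} {Q : Pred (loc ∷ Δ)} {ts} → x ∈ˢ ts → x ∈Σ pred Q ts
    ∗ˡ     : ∀ {Σ₁ Σ₂} → x ∈Σ Σ₁ → x ∈Σ (Σ₁ ∗ Σ₂)
    ∗ʳ     : ∀ {Σ₁ Σ₂} → x ∈Σ Σ₂ → x ∈Σ (Σ₁ ∗ Σ₂)

  -- Positions at which A occurs in a separating conjunction.
  data _◂_ {Γ} (A : Spatial Γ) : Spatial Γ → Set where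
    whole : A ◂ A
    left  : ∀ {Σ₁ Σ₂} → A ◂ Σ₁ → A ◂ (Σ₁ ∗ Σ₂)
    right : ∀ {Σ₁ Σ₂} → A ◂ Σ₂ → A ◂ (Σ₁ ∗ Σ₂)

  HasPred : ∀ {Γ} → Spatial Γ → Set
  HasPred Σ = ∃[ Δ ] Σ[ Q ∈ Pred (loc ∷ Δ) ] ∃[ ts ] (pred Q ts ◂ Σ)

  IsInductiveRule IsBaseRule : ∀ {Γ} → Rule Γ → Set
  IsInductiveRule r = HasPred (Rule.spatialᴿ r)
  IsBaseRule      r = ¬ IsInductiveRule r

  record Heap : Set where
    field
      at : Loc → ∀ {σ} → Field σ → Maybe (Val σ)

    infix 4 _∈dom
    _∈dom : (Loc × ∃ Field) → Set
    (l , σ , f) ∈dom = Is-just (at l f)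

    field
      cells  : List (Loc × ∃ Field)
      finite : ∀ {c} → c ∈dom → c ∈ cells

  open Heap public using (at)

  infix 4 _∈dom_
  _∈dom_ : (Loc × ∃ Field) → Heap → Set
  c ∈dom h = Heap._∈dom h c

  Empty : Heap → Set
  Empty h = ∀ {c} → ¬ c ∈dom h

  -- Disjointness is of sets of (location, field) pairs, not of locations.
  infix 4 _≔_⊎ʰ_

  record _≔_⊎ʰ_ (h h₁ h₂ : Heap) : Set where
    field
      disjoint : ∀ {c} → c ∈dom h₁ → ¬ c ∈dom h₂
      union    : ∀ l {σ} (f : Field σ) → at h l f ≡ (at h₁ l f <∣> at h₂ l f)

  Stack : Ctx → Set
  Stack = All Val

  ⟦_⟧ᵗ : ∀ {Γ σ} → Term Γ σ → Stack Γ → Val σ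
  ⟦ var x ⟧ᵗ   s = All.lookup s x
  ⟦ const c ⟧ᵗ s = ⟦ c ⟧ᶜ

  ⟦_⟧ˢ : ∀ {Γ Δ} → Terms Γ Δ → Stack Γ → Stack Δ
  ⟦ ts ⟧ˢ s = All.map (λ t → ⟦ t ⟧ᵗ s) ts

  infix 3 _⊨ᴾ_
  _⊨ᴾ_ : ∀ {Γ} → Stack Γ → Pure Γ → Set
  s ⊨ᴾ t ≐ u        = ⟦ t ⟧ᵗ s ≡ ⟦ u ⟧ᵗ s
  s ⊨ᴾ t ≠ₗ u       = ⟦ t ⟧ᵗ s ≢ ⟦ u ⟧ᵗ s
  s ⊨ᴾ data⟨ φ ⟩ ts = Holds φ (Vec.map (λ t → ⟦ t ⟧ᵗ s) ts)
  s ⊨ᴾ Π₁ ∧ᵖ Π₂     = (s ⊨ᴾ Π₁) × (s ⊨ᴾ Π₂)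

  module _ ⦃ 𝒟 : Definitions ⦄ where

    -- The least fixed point of the rules is the inductive family itself: a
    -- predicate atom is satisfied exactly by finite unfoldings.
    infix 3 _,_⊨Σ_

    data _,_⊨Σ_ {Γ} (s : Stack Γ) (h : Heap) : Spatial Γ → Set where
      emp⁺  : Empty h → s , h ⊨Σ emp
      ↦⁺    : ∀ {t ρ} →
              (∀ {σ} {f : Field σ} {u} → (σ , f , u) ∈ ρ →
                 at h (⟦ t ⟧ᵗ s) f ≡ just (⟦ u ⟧ᵗ s)) →
              (∀ {l σ} {f : Field σ} → (l , σ , f) ∈dom h →
                 l ≡ ⟦ t ⟧ᵗ s × ∃[ u ] (σ , f , u) ∈ ρ) →
              s , h ⊨Σ t ↦ ρ
      ∗⁺    : ∀ {Σ₁ Σ₂} h₁ h₂ → h ≔ h₁ ⊎ʰ h₂ →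
              s , h₁ ⊨Σ Σ₁ → s , h₂ ⊨Σ Σ₂ → s , h ⊨Σ Σ₁ ∗ Σ₂
      pred⁺ : ∀ {Δ} {Q : Pred (loc ∷ Δ)} {ts Z Π Σ} →
              (∃⟨ Z ⟩ Π ∧ Σ) ∈ rules Q →
              (zs : Stack Z) →
              ++⁺ zs (⟦ ts ⟧ˢ s) ⊨ᴾ Π →
              ++⁺ zs (⟦ ts ⟧ˢ s) , h ⊨Σ Σ →
              s , h ⊨Σ pred Q ts

    infix 3 _,_⊨_
    _,_⊨_ : ∀ {Γ} → Stack Γ → Heap → Formula Γ → Set
    s , h ⊨ pure Π     = s ⊨ᴾ Π
    s , h ⊨ spatial Σ  = s , h ⊨Σ Σ
    s , h ⊨ A ∧ B      = (s , h ⊨ A) × (s , h ⊨ B)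
    s , h ⊨ A ∨ B      = (s , h ⊨ A) ⊎ (s , h ⊨ B)
    s , h ⊨ exists Z A = Σ[ zs ∈ Stack Z ] (++⁺ zs s , h ⊨ A)

    infix 3 _⟹_ _⟺_
    _⟹_ : ∀ {Γ} → Formula Γ → Formula Γ → Set
    A ⟹ B = ∀ s h → s , h ⊨ A → s , h ⊨ B

    _⟺_ : ∀ {Γ} → Formula Γ → Formula Γ → Set
    A ⟺ B = (A ⟹ B) × (B ⟹ A)

  -- The Gaifman graph of a separating conjunction of points-to atoms. Its
  -- vertices are location variables; constants are not vertices.

  module Gaifman {Γ} (Σ : Spatial Γ) where

    Vertex : loc ∈ Γ → Set
    Vertex x = x ∈Σ Σ

    Edge : loc ∈ Γ → loc ∈ Γ → Set
    Edge x y = ∃[ ρ ] Σ[ f ∈ Field loc ] (var x ↦ ρ) ◂ Σ × (loc , f , var y) ∈ ρ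

    Acyclic : Set
    Acyclic = ∀ x → ¬ TransClosure Edge x x

    -- In particular the underlying undirected graph is connected.
    RootedAt : loc ∈ Γ → Set
    RootedAt e = Vertex e × (∀ x → Vertex x → Star Edge e x)

    Sink : loc ∈ Γ → Set
    Sink x = Vertex x × (∀ y → ¬ Edge x y)

  -- Separating conjunctions, bracketed arbitrarily: one or more points-to
  -- atoms from variables, respectively zero or more predicate atoms.
  data PointsTos {Γ} : Spatial Γ → Set where
    atom : ∀ {x ρ} → PointsTos (var x ↦ ρ)
    _∗_  : ∀ {Σ₁ Σ₂} → PointsTos Σ₁ → PointsTos Σ₂ → PointsTos (Σ₁ ∗ Σ₂)

  data Preds {Γ} : Spatial Γ → Set where
    emp  : Preds emp
    atom : ∀ {Δ} {Q : Pred (loc ∷ Δ)} {ts} → Preds (pred Q ts)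
    _∗_  : ∀ {Σ₁ Σ₂} → Preds Σ₁ → Preds Σ₂ → Preds (Σ₁ ∗ Σ₂)

  module _ {ξ : Ctx} where

    -- The parameters (α, β, ξ) of P and (α, ξ) of its completion, with
    -- α = (E, C) and β = (F, H).
    αβξ αξ : Ctx
    αβξ = loc ∷ dat ∷ loc ∷ dat ∷ ξ
    αξ  = loc ∷ dat ∷ ξ

    -- The constituents Z, Π, Σ₁, Σ₂, γ of an inductive rule of P.
    record Step : Set where
      field
        Z     : Ctx
        Π     : Pure (Z ++ αβξ)
        Σ₁ Σ₂ : Spatial (Z ++ αβξ)
        γ₁    : loc ∈ Z
        γ₂    : dat ∈ Z

      param : ∀ {σ} → σ ∈ αβξ → σ ∈ Z ++ αβξ
      param = ∈-++⁺ʳ Z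

      E : loc ∈ Z ++ αβξ
      E = param ₀

      F : loc ∈ Z ++ αβξ
      F = param ₂

      H : dat ∈ Z ++ αβξ
      H = param ₃

    -- P(α, β, ξ) ::= α₁ = β₁ ∧ α₂ = β₂ ∧ emp
    baseRule : Rule αβξ
    baseRule = ∃⟨ [] ⟩ (var ₀ ≐ var ₂ ∧ᵖ var ₁ ≐ var ₃) ∧ emp

    -- P(α, β, ξ) ::= ∃Z. Π ∧ Σ₁ ∗ Σ₂ ∗ P(γ, β, ξ)
    stepRule : Pred αβξ → Step → Rule αβξ
    stepRule P step = ∃⟨ Z ⟩ Π ∧ (Σ₁ ∗ Σ₂ ∗ pred P γβξ)
      where
      open Step step
      γβξ : Terms (Z ++ αβξ) αβξ
      γβξ = var (∈-++⁺ˡ γ₁) ∷ var (∈-++⁺ˡ γ₂) ∷ var F ∷ var H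
          ∷ vars (param ∘ there ∘ there ∘ there ∘ there)

    -- That β does not occur in γ is implied by γ being variables of Z.
    record Admissible (step : Step) : Set where
      open Step step
      open Gaifman Σ₁
      field
        pointsTos : PointsTos Σ₁
        -- Uniqueness is of positions, so repeated atoms are excluded too.
        unique    : Σ[ o ∈ ∃[ ρ ] (var E ↦ ρ) ◂ Σ₁ ]
                      ((o′ : ∃[ ρ ] (var E ↦ ρ) ◂ Σ₁) → o ≡ o′)
        covers    : ∀ (z : loc ∈ Z) → ∈-++⁺ˡ z ∈Σ Σ₁
        acyclic   : Acyclic
        rooted    : RootedAt E
        preds     : Preds Σ₂
        sinks     : ∀ {Δ} {Q : Pred (loc ∷ Δ)} {ts} → pred Q ts ◂ Σ₂ →
                    ∃[ x ] All.head ts ≡ var x × Sink x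
        F∉Π       : ¬ F ∈ᴾ Π
        H∉Π       : ¬ H ∈ᴾ Π
        F∉Σ₁      : ¬ F ∈Σ Σ₁
        H∉Σ₁      : ¬ H ∈Σ Σ₁
        F∉Σ₂      : ¬ F ∈Σ Σ₂
        H∉Σ₂      : ¬ H ∈Σ Σ₂

    record SyntacticallyCompositional ⦃ 𝒟 : Definitions ⦄ (P : Pred αβξ) : Set where
      field
        base-rule      : baseRule ∈ rules P
        base-unique    : ∀ {r} → r ∈ rules P → IsBaseRule r → r ≡ baseRule
        inductive-rule : ∃[ r ] r ∈ rules P × IsInductiveRule r
        inductive-form : ∀ {r} → r ∈ rules P → IsInductiveRule r →
                         ∃[ step ] r ≡ stepRule P step × Admissible step

    module _ (c₁ : Const loc) (c₂ : Const dat) where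

      -- The substitution β ↦ c under the binder ∃Z.
      β↦c : ∀ Z → Terms (Z ++ αξ) (Z ++ αβξ)
      β↦c Z = ++⁺ (vars ∈-++⁺ˡ)
                  (var (p ₀) ∷ var (p ₁) ∷ const c₁ ∷ const c₂
                   ∷ vars (p ∘ there ∘ there))
        where
        p : ∀ {σ} → σ ∈ αξ → σ ∈ Z ++ αξ
        p = ∈-++⁺ʳ Z

      -- P′(α, ξ) ::= α₁ = c₁ ∧ α₂ = c₂ ∧ emp
      completedBase : Rule αξ
      completedBase = ∃⟨ [] ⟩ (var ₀ ≐ const c₁ ∧ᵖ var ₁ ≐ const c₂) ∧ emp

      -- P′(α, ξ) ::= ∃Z. Π ∧ Σ₁ ∗ Σ₂ ∗ P′(γ, ξ)
      completedStep : Pred αξ → Step → Rule αξ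
      completedStep P′ step =
        ∃⟨ Z ⟩ substᴾ θ Π ∧ (substΣ θ Σ₁ ∗ substΣ θ Σ₂ ∗ pred P′ γξ)
        where
        open Step step
        θ : Terms (Z ++ αξ) (Z ++ αβξ)
        θ = β↦c Z
        γξ : Terms (Z ++ αξ) αξ
        γξ = var (∈-++⁺ˡ γ₁) ∷ var (∈-++⁺ˡ γ₂)
           ∷ vars (∈-++⁺ʳ Z ∘ there ∘ there)

      IsCompletion : ⦃ 𝒟 : Definitions ⦄ → Pred αβξ → Pred αξ → Set
      IsCompletion P P′ = ∀ {r} →
        r ∈ rules P′ ⇔ (r ≡ completedBase ⊎
                     (∃[ step ] stepRule P step ∈ rules P × r ≡ completedStep P′ step))

    infix 8 _⟨_∣_∣_⟩ _⟨_∣_⟩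

    _⟨_∣_∣_⟩ : ∀ {Γ} → Pred αβξ → Terms Γ (loc ∷ dat ∷ []) →
               Terms Γ (loc ∷ dat ∷ []) → Terms Γ ξ → Spatial Γ
    P ⟨ α ∣ β ∣ x ⟩ = pred P (++⁺ α (++⁺ β x))

    _⟨_∣_⟩ : ∀ {Γ} → Pred αξ → Terms Γ (loc ∷ dat ∷ []) → Terms Γ ξ → Spatial Γ
    P′ ⟨ α ∣ x ⟩ = pred P′ (++⁺ α x)

{-# OPTIONS --safe #-}

-- P(α, β, ξ) is a chain of steps that ends in β, and the steps do not mention β.
-- Hence, by induction on the unfolding of P, a chain from α to β followed by an
-- unfolding of P′(β, ξ) can be rebuilt, step by step, as an unfolding of
-- P′(α, ξ). The direction P(α, c, ξ) ⟹ P′(α, ξ) is the special case in which the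
-- second heap is empty, and the converse is an induction on the unfolding of P′.
module Submission where

open import Defs
open import Data.List.Base using ([]; _∷_; _++_)
open import Data.List.Membership.Propositional using (_∈_)
open import Data.List.Membership.Propositional.Properties using (∈-++⁺ˡ; ∈-++⁺ʳ; ∈-++⁻)
open import Data.List.Relation.Unary.All as All using (All; []; _∷_)
open import Data.List.Relation.Unary.All.Properties using (++⁺)
open import Data.List.Relation.Unary.Any using (here; there)
open import Data.List.Relation.Unary.Any.Properties using (++⁺∘++⁻)
open import Data.Maybe using (Maybe; just; nothing; Is-just; _<∣>_)
open import Data.Maybe.Properties using (<∣>-assoc; <∣>-identityʳ)
open import Data.Maybe.Relation.Unary.Any using (just)
open import Data.Product.Base using (_×_; _,_; ∃-syntax)
open import Data.Sum.Base using (_⊎_; inj₁; inj₂; [_,_]′)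
open import Data.Vec.Base as Vec using (Vec)
open import Function.Base using (_∘_; case_of_)
open import Function.Bundles using (module Equivalence)
open import Relation.Binary.PropositionalEquality
  using (_≡_; refl; sym; trans; cong; cong₂; subst)
open import Relation.Nullary using (¬_; Dec; yes; no; contradiction)
open import Relation.Nullary.Decidable using (map′; _⊎-dec_)

-- Lookup in concatenated tuples, and definedness of `_<∣>_`.

module _ {A : Set} {P : A → Set} where

  lookup-++⁺ˡ : ∀ {xs ys y} (ps : All P xs) (qs : All P ys) (i : y ∈ xs) →
                All.lookup (++⁺ ps qs) (∈-++⁺ˡ i) ≡ All.lookup ps i
  lookup-++⁺ˡ (p ∷ ps) qs (here refl) = refl
  lookup-++⁺ˡ (p ∷ ps) qs (there i)   = lookup-++⁺ˡ ps qs i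

  lookup-++⁺ʳ : ∀ {xs ys y} (ps : All P xs) (qs : All P ys) (i : y ∈ ys) →
                All.lookup (++⁺ ps qs) (∈-++⁺ʳ xs i) ≡ All.lookup qs i
  lookup-++⁺ʳ []       qs i = refl
  lookup-++⁺ʳ (p ∷ ps) qs i = lookup-++⁺ʳ ps qs i

  lookup-tabulate : ∀ {xs y} (f : ∀ {x} → x ∈ xs → P x) (i : y ∈ xs) →
                    All.lookup (All.tabulate f) i ≡ f i
  lookup-tabulate f (here refl) = refl
  lookup-tabulate f (there i)   = lookup-tabulate (f ∘ there) i

module _ {A : Set} where

  Is-just-<∣>⁺ˡ : {m n : Maybe A} → Is-just m → Is-just (m <∣> n)
  Is-just-<∣>⁺ˡ (just p) = just p

  Is-just-<∣>⁺ʳ : (m : Maybe A) {n : Maybe A} → Is-just n → Is-just (m <∣> n)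
  Is-just-<∣>⁺ʳ (just x) p = just _
  Is-just-<∣>⁺ʳ nothing  p = p

  Is-just-<∣>⁻ : (m : Maybe A) {n : Maybe A} → Is-just (m <∣> n) → Is-just m ⊎ Is-just n
  Is-just-<∣>⁻ (just x) p = inj₁ p
  Is-just-<∣>⁻ nothing  p = inj₂ p

-- Heaps: pointwise equality, the empty heap, disjoint unions.

module _ ⦃ S : Signature ⦄ where

  -- Heaps also carry `cells` and a finiteness proof, so heaps with the same content need not be
  -- propositionally equal.
  infix 4 _≗ʰ_
  _≗ʰ_ : Heap → Heap → Set
  h ≗ʰ k = ∀ l {σ} (f : Field σ) → at h l f ≡ at k l f

  ≗ʰ-∈dom : ∀ {h k c} → h ≗ʰ k → c ∈dom k → c ∈dom h
  ≗ʰ-∈dom {c = l , σ , f} eq = subst Is-just (sym (eq l f))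

  module _ {h h₁ h₂} (u : h ≔ h₁ ⊎ʰ h₂) where
    open _≔_⊎ʰ_ u

    ∈dom-⊎ʰˡ : ∀ {c} → c ∈dom h₁ → c ∈dom h
    ∈dom-⊎ʰˡ {l , σ , f} i = subst Is-just (sym (union l f)) (Is-just-<∣>⁺ˡ i)

    ∈dom-⊎ʰʳ : ∀ {c} → c ∈dom h₂ → c ∈dom h
    ∈dom-⊎ʰʳ {l , σ , f} i = subst Is-just (sym (union l f)) (Is-just-<∣>⁺ʳ (at h₁ l f) i)

    ⊎ʰ-emptyˡ⁻ : Empty h₁ → h ≗ʰ h₂
    ⊎ʰ-emptyˡ⁻ empty l f with at h₁ l f in eq | union l f
    ... | nothing | h≡h₂ = h≡h₂
    ... | just _  | _    = contradiction (subst Is-just (sym eq) (just _)) empty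

  emptyʰ : Heap
  emptyʰ = record { at = λ _ _ → nothing ; cells = [] ; finite = λ () }

  ⊎ʰ-emptyʳ : ∀ h → h ≔ h ⊎ʰ emptyʰ
  ⊎ʰ-emptyʳ h = record
    { disjoint = λ { _ () }
    ; union    = λ l f → sym (<∣>-identityʳ (at h l f))
    }

  -- Total and left-biased; disjointness is established separately, in `⊎ʰ-assoc`.
  _∪ʰ_ : Heap → Heap → Heap
  h ∪ʰ k = record
    { at     = λ l f → at h l f <∣> at k l f
    ; cells  = Heap.cells h ++ Heap.cells k
    ; finite = λ { {l , σ , f} i →
        [ ∈-++⁺ˡ ∘ Heap.finite h , ∈-++⁺ʳ _ ∘ Heap.finite k ]′ (Is-just-<∣>⁻ (at h l f) i) }
    }

  -- Peels `k₁` off the front and merges the rest of `h₁` with `h₂`. The part `k₁` is disjoint from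
  -- `h₂` because its domain lies inside that of `h₁`.
  ⊎ʰ-assoc : ∀ {h h₁ h₂ k₁ k₂} → h ≔ h₁ ⊎ʰ h₂ → h₁ ≔ k₁ ⊎ʰ k₂ →
             h ≔ k₁ ⊎ʰ (k₂ ∪ʰ h₂) × (k₂ ∪ʰ h₂) ≔ k₂ ⊎ʰ h₂
  ⊎ʰ-assoc {h₂ = h₂} {k₁} {k₂} u v =
    record
      { disjoint = λ { {l , σ , f} i j →
          [ V.disjoint i , U.disjoint (∈dom-⊎ʰˡ v i) ]′ (Is-just-<∣>⁻ (at k₂ l f) j) }
      ; union    = λ l f → trans (U.union l f)
          (trans (cong (_<∣> at h₂ l f) (V.union l f)) (<∣>-assoc (at k₁ l f) _ _))
      }
    , record
      { disjoint = U.disjoint ∘ ∈dom-⊎ʰʳ v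
      ; union    = λ _ _ → refl
      }
    where
    module U = _≔_⊎ʰ_ u
    module V = _≔_⊎ʰ_ v

  -- Evaluation, substitution and the classification of rules.

  ⟦vars⟧ : ∀ {Γ Δ} {s : Stack Γ} {f : ∀ {σ} → σ ∈ Δ → σ ∈ Γ} (x : Stack Δ) →
           (∀ {σ} (i : σ ∈ Δ) → All.lookup s (f i) ≡ All.lookup x i) →
           ⟦ vars f ⟧ˢ s ≡ x
  ⟦vars⟧ []      eq = refl
  ⟦vars⟧ (v ∷ x) eq = cong₂ _∷_ (eq ₀) (⟦vars⟧ x (eq ∘ there))

  -- Base rules are defined as the negation of inductive ones, so a constructive case distinction on
  -- a rule needs this decision.
  hasPred? : ∀ {Γ} (Σ : Spatial Γ) → Dec (HasPred Σ)
  hasPred? emp         = no λ { (_ , _ , _ , ()) }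
  hasPred? (t ↦ ρ)     = no λ { (_ , _ , _ , ()) }
  hasPred? (pred Q ts) = yes (_ , Q , ts , whole)
  hasPred? (Σ₁ ∗ Σ₂)   =
    map′ (λ { (inj₁ (_ , _ , _ , p)) → _ , _ , _ , left p
            ; (inj₂ (_ , _ , _ , p)) → _ , _ , _ , right p })
         (λ { (_ , _ , _ , left p)  → inj₁ (_ , _ , _ , p)
            ; (_ , _ , _ , right p) → inj₂ (_ , _ , _ , p) })
         (hasPred? Σ₁ ⊎-dec hasPred? Σ₂)

  -- Substitution and coincidence in one: s and s′ need to agree along θ only on
  -- the variables that occur.
  module Substitution {Γ Δ} (θ : Terms Γ Δ) (s : Stack Γ) (s′ : Stack Δ) where

    AgreeOn : (∀ {σ} → σ ∈ Δ → Set) → Set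
    AgreeOn Occurs = ∀ {σ} {y : σ ∈ Δ} → Occurs y → ⟦ All.lookup θ y ⟧ᵗ s ≡ All.lookup s′ y

    ⟦substᵗ⟧ : ∀ {σ} (t : Term Δ σ) → AgreeOn (_∈ᵗ t) → ⟦ substᵗ θ t ⟧ᵗ s ≡ ⟦ t ⟧ᵗ s′
    ⟦substᵗ⟧ (var y)   agree = agree var
    ⟦substᵗ⟧ (const c) agree = refl

    ⟦substᵛ⟧ : ∀ {n} (ts : Vec (Term Δ dat) n) → AgreeOn (_∈ᵛ ts) →
               Vec.map (λ t → ⟦ t ⟧ᵗ s) (Vec.map (substᵗ θ) ts) ≡ Vec.map (λ t → ⟦ t ⟧ᵗ s′) ts
    ⟦substᵛ⟧ Vec.[]       agree = refl
    ⟦substᵛ⟧ (t Vec.∷ ts) agree =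
      cong₂ Vec._∷_ (⟦substᵗ⟧ t (agree ∘ head)) (⟦substᵛ⟧ ts (agree ∘ tail))

    ⟦substˢ⟧ : ∀ {Ξ} (ts : Terms Δ Ξ) → AgreeOn (_∈ˢ ts) → ⟦ substˢ θ ts ⟧ˢ s ≡ ⟦ ts ⟧ˢ s′
    ⟦substˢ⟧ []       agree = refl
    ⟦substˢ⟧ (t ∷ ts) agree = cong₂ _∷_ (⟦substᵗ⟧ t (agree ∘ head)) (⟦substˢ⟧ ts (agree ∘ tail))

    substᴾ⁺ : ∀ Π → AgreeOn (_∈ᴾ Π) → s′ ⊨ᴾ Π → s ⊨ᴾ substᴾ θ Π
    substᴾ⁺ (t ≐ u)        agree p =
      trans (⟦substᵗ⟧ t (agree ∘ ≐ˡ)) (trans p (sym (⟦substᵗ⟧ u (agree ∘ ≐ʳ))))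
    substᴾ⁺ (t ≠ₗ u)       agree p q =
      p (trans (sym (⟦substᵗ⟧ t (agree ∘ ≠ˡ))) (trans q (⟦substᵗ⟧ u (agree ∘ ≠ʳ))))
    substᴾ⁺ (data⟨ φ ⟩ ts) agree p = subst (Holds φ) (sym (⟦substᵛ⟧ ts (agree ∘ data⟨⟩))) p
    substᴾ⁺ (Π₁ ∧ᵖ Π₂)     agree (p₁ , p₂) =
      substᴾ⁺ Π₁ (agree ∘ ∧ˡ) p₁ , substᴾ⁺ Π₂ (agree ∘ ∧ʳ) p₂

    substᴾ⁻ : ∀ Π → AgreeOn (_∈ᴾ Π) → s ⊨ᴾ substᴾ θ Π → s′ ⊨ᴾ Π
    substᴾ⁻ (t ≐ u)        agree p =
      trans (sym (⟦substᵗ⟧ t (agree ∘ ≐ˡ))) (trans p (⟦substᵗ⟧ u (agree ∘ ≐ʳ)))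
    substᴾ⁻ (t ≠ₗ u)       agree p q =
      p (trans (⟦substᵗ⟧ t (agree ∘ ≠ˡ)) (trans q (sym (⟦substᵗ⟧ u (agree ∘ ≠ʳ)))))
    substᴾ⁻ (data⟨ φ ⟩ ts) agree p = subst (Holds φ) (⟦substᵛ⟧ ts (agree ∘ data⟨⟩)) p
    substᴾ⁻ (Π₁ ∧ᵖ Π₂)     agree (p₁ , p₂) =
      substᴾ⁻ Π₁ (agree ∘ ∧ˡ) p₁ , substᴾ⁻ Π₂ (agree ∘ ∧ʳ) p₂

  ∈-substᴿ⁺ : ∀ {Γ Δ} {θ : Terms Γ Δ} {ρ σ} {f : Field σ} {t} →
              (σ , f , t) ∈ ρ → (σ , f , substᵗ θ t) ∈ substᴿ θ ρ
  ∈-substᴿ⁺ (here refl) = here refl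
  ∈-substᴿ⁺ (there i)   = there (∈-substᴿ⁺ i)

  ∈-substᴿ⁻ : ∀ {Γ Δ} {θ : Terms Γ Δ} ρ {σ} {f : Field σ} {u} →
              (σ , f , u) ∈ substᴿ θ ρ → ∃[ t ] (σ , f , t) ∈ ρ × u ≡ substᵗ θ t
  ∈-substᴿ⁻ (_ ∷ ρ) (here refl) = _ , here refl , refl
  ∈-substᴿ⁻ (_ ∷ ρ) (there i)   with t , j , eq ← ∈-substᴿ⁻ ρ i = t , there j , eq

  -- Invariance of satisfaction under heap equality and substitution.

  module _ ⦃ 𝒟 : Definitions ⦄ where

    -- Only `emp` and `↦` inspect the cells. At a separating conjunction the same two halves also
    -- split the other heap.
    ⊨Σ-resp-≗ʰ : ∀ {Γ} {s : Stack Γ} {h k Σ} → h ≗ʰ k → s , k ⊨Σ Σ → s , h ⊨Σ Σ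
    ⊨Σ-resp-≗ʰ {h = h} {k} eq (emp⁺ empty) = emp⁺ (empty ∘ ≗ʰ-∈dom {k} {h} (λ l f → sym (eq l f)))
    ⊨Σ-resp-≗ʰ {h = h} {k} eq (↦⁺ stored only) =
      ↦⁺ (λ i → trans (eq _ _) (stored i)) (only ∘ ≗ʰ-∈dom {k} {h} (λ l f → sym (eq l f)))
    ⊨Σ-resp-≗ʰ eq (∗⁺ h₁ h₂ u d₁ d₂) = ∗⁺ h₁ h₂ u′ d₁ d₂
      where
      open _≔_⊎ʰ_ u
      u′ = record { disjoint = disjoint ; union = λ l f → trans (eq l f) (union l f) }
    ⊨Σ-resp-≗ʰ eq (pred⁺ r zs p d) = pred⁺ r zs p (⊨Σ-resp-≗ʰ eq d)

    -- `pred⁺` with the argument values generalized to `v`, so that the body may be given over any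
    -- provably equal stack.
    fold : ∀ {Γ} {s : Stack Γ} {h Δ} {Q : Pred (loc ∷ Δ)} {ts Z Π Σ v} →
           ⟦ ts ⟧ˢ s ≡ v → (∃⟨ Z ⟩ Π ∧ Σ) ∈ rules Q → (zs : Stack Z) →
           ++⁺ zs v ⊨ᴾ Π → ++⁺ zs v , h ⊨Σ Σ → s , h ⊨Σ pred Q ts
    fold refl = pred⁺

    -- A rule body is evaluated over the argument values and the bound variables alone, so an
    -- unfolding can move to another context.
    pred-cong : ∀ {Γ Γ′} {s : Stack Γ} {s′ : Stack Γ′} {h Δ} {Q : Pred (loc ∷ Δ)} {ts ts′} →
                ⟦ ts′ ⟧ˢ s′ ≡ ⟦ ts ⟧ˢ s → s , h ⊨Σ pred Q ts → s′ , h ⊨Σ pred Q ts′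
    pred-cong eq (pred⁺ r zs p d) = fold eq r zs p d

    module SubstitutionΣ {Γ Δ} (θ : Terms Γ Δ) (s : Stack Γ) (s′ : Stack Δ) where
      open Substitution θ s s′

      substΣ⁺ : ∀ {h} Σ → AgreeOn (_∈Σ Σ) → s′ , h ⊨Σ Σ → s , h ⊨Σ substΣ θ Σ
      substΣ⁺ emp         agree (emp⁺ empty) = emp⁺ empty
      substΣ⁺ {h} (t ↦ ρ) agree (↦⁺ stored only) = ↦⁺
        (λ {_} {f} i → case ∈-substᴿ⁻ ρ i of λ { (u , j , refl) →
          subst (λ l → at h l f ≡ _) (sym (⟦substᵗ⟧ t (agree ∘ source)))
            (trans (stored j) (cong just (sym (⟦substᵗ⟧ u (agree ∘ target j))))) })
        (λ i → case only i of λ { (eq , u , j) →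
          trans eq (sym (⟦substᵗ⟧ t (agree ∘ source))) , _ , ∈-substᴿ⁺ j })
      -- The unfolding is kept as it is: substitution touches only the arguments, whose values
      -- agree.
      substΣ⁺ (pred Q ts) agree d = pred-cong (⟦substˢ⟧ ts (agree ∘ arg)) d
      substΣ⁺ (Σ₁ ∗ Σ₂)   agree (∗⁺ h₁ h₂ u d₁ d₂) =
        ∗⁺ h₁ h₂ u (substΣ⁺ Σ₁ (agree ∘ ∗ˡ) d₁) (substΣ⁺ Σ₂ (agree ∘ ∗ʳ) d₂)

      substΣ⁻ : ∀ {h} Σ → AgreeOn (_∈Σ Σ) → s , h ⊨Σ substΣ θ Σ → s′ , h ⊨Σ Σ
      substΣ⁻ emp         agree (emp⁺ empty) = emp⁺ empty
      substΣ⁻ {h} (t ↦ ρ) agree (↦⁺ stored only) = ↦⁺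
        (λ {_} {f} {u} j →
          subst (λ l → at h l f ≡ _) (⟦substᵗ⟧ t (agree ∘ source))
            (trans (stored (∈-substᴿ⁺ j)) (cong just (⟦substᵗ⟧ u (agree ∘ target j)))))
        (λ i → case only i of λ { (eq , _ , i′) → case ∈-substᴿ⁻ ρ i′ of λ { (u , j , _) →
          trans eq (⟦substᵗ⟧ t (agree ∘ source)) , u , j } })
      substΣ⁻ (pred Q ts) agree d = pred-cong (sym (⟦substˢ⟧ ts (agree ∘ arg))) d
      substΣ⁻ (Σ₁ ∗ Σ₂)   agree (∗⁺ h₁ h₂ u d₁ d₂) =
        ∗⁺ h₁ h₂ u (substΣ⁻ Σ₁ (agree ∘ ∗ˡ) d₁) (substΣ⁻ Σ₂ (agree ∘ ∗ʳ) d₂)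

    -- The substitution of the constants for the hole, and the arguments of recursive atoms.

    module _ {ξ : Ctx} {c₁ : Const loc} {c₂ : Const dat} where

      -- The hole must have the values of the constants only where it occurs. This covers both a
      -- hole that is absent, with arbitrary values, and a hole that does have these values.
      β↦c-agrees : ∀ {Z a₁ a₂ b₁ b₂} {x : Stack ξ} (zs : Stack Z) →
        (Occurs : ∀ {σ} → σ ∈ Z ++ αβξ {ξ} → Set) →
        (Occurs (∈-++⁺ʳ Z ₂) → ⟦ c₁ ⟧ᶜ ≡ b₁) →
        (Occurs (∈-++⁺ʳ Z ₃) → ⟦ c₂ ⟧ᶜ ≡ b₂) →
        Substitution.AgreeOn (β↦c {ξ} c₁ c₂ Z)
          (++⁺ zs (a₁ ∷ a₂ ∷ x)) (++⁺ zs (a₁ ∷ a₂ ∷ b₁ ∷ b₂ ∷ x)) Occurs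
      β↦c-agrees {Z} {a₁} {a₂} {b₁} {b₂} {x} zs Occurs F≡ H≡ {y = y} o
        -- Matching on the round trip replaces `y` by the injection of a bound variable or of a
        -- parameter.
        with ∈-++⁻ Z y | ++⁺∘++⁻ Z y
      ... | inj₁ z | refl =
        trans (cong (λ t → ⟦ t ⟧ᵗ s)
                (trans (lookup-++⁺ˡ (vars ∈-++⁺ˡ) _ z) (lookup-tabulate (var ∘ ∈-++⁺ˡ) z)))
          (trans (lookup-++⁺ˡ zs _ z) (sym (lookup-++⁺ˡ zs _ z)))
        where s = ++⁺ zs (a₁ ∷ a₂ ∷ x)
      ... | inj₂ i | refl =
        trans (cong (λ t → ⟦ t ⟧ᵗ s) (lookup-++⁺ʳ (vars {Γ = Z ++ αξ {ξ}} {Z} ∈-++⁺ˡ) θ i))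
          (trans (onParameters i o) (sym (lookup-++⁺ʳ zs _ i)))
        where
        s = ++⁺ zs (a₁ ∷ a₂ ∷ x)

        θ : Terms (Z ++ αξ {ξ}) (αβξ {ξ})
        θ = var (∈-++⁺ʳ Z ₀) ∷ var (∈-++⁺ʳ Z ₁) ∷ const c₁ ∷ const c₂
          ∷ vars (∈-++⁺ʳ Z ∘ there ∘ there)

        onParameters : ∀ {σ} (i : σ ∈ αβξ {ξ}) → Occurs (∈-++⁺ʳ Z i) →
          ⟦ All.lookup θ i ⟧ᵗ s ≡ All.lookup (a₁ ∷ a₂ ∷ b₁ ∷ b₂ ∷ x) i
        onParameters ₀ o = lookup-++⁺ʳ zs _ ₀
        onParameters ₁ o = lookup-++⁺ʳ zs _ ₁
        onParameters ₂ o = F≡ o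
        onParameters ₃ o = H≡ o
        -- Removing the two hole parameters lowers the index of a static parameter by two.
        onParameters (there (there (there (there j)))) o =
          trans (cong (λ t → ⟦ t ⟧ᵗ s) (lookup-tabulate (var ∘ ∈-++⁺ʳ Z ∘ there ∘ there) j))
            (lookup-++⁺ʳ zs _ (there (there j)))

    module _ {ξ : Ctx} {Z : Ctx} (γ₁ : loc ∈ Z) (γ₂ : dat ∈ Z) (zs : Stack Z) where

      -- The tuple is the one local to `stepRule`. A step moves the source to `γ` and leaves hole
      -- and static parameters fixed, as the inductions below require.
      ⟦γβξ⟧ : ∀ {v : Stack αβξ} {a₁ a₂ b₁ b₂} {x : Stack ξ} → v ≡ a₁ ∷ a₂ ∷ b₁ ∷ b₂ ∷ x →
        ⟦ var (∈-++⁺ˡ γ₁) ∷ var (∈-++⁺ˡ γ₂) ∷ var (∈-++⁺ʳ Z ₂) ∷ var (∈-++⁺ʳ Z ₃)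
          ∷ vars (∈-++⁺ʳ Z ∘ there ∘ there ∘ there ∘ there) ⟧ˢ (++⁺ zs v)
        ≡ All.lookup zs γ₁ ∷ All.lookup zs γ₂ ∷ b₁ ∷ b₂ ∷ x
      ⟦γβξ⟧ refl =
        cong₂ _∷_ (lookup-++⁺ˡ zs _ γ₁) (cong₂ _∷_ (lookup-++⁺ˡ zs _ γ₂)
          (cong₂ _∷_ (lookup-++⁺ʳ zs _ ₂) (cong₂ _∷_ (lookup-++⁺ʳ zs _ ₃)
            (⟦vars⟧ _ (λ i → lookup-++⁺ʳ zs _ (there (there (there (there i)))))))))

      ⟦γξ⟧ : ∀ {v : Stack αξ} {a₁ a₂} {x : Stack ξ} → v ≡ a₁ ∷ a₂ ∷ x →
        ⟦ var (∈-++⁺ˡ γ₁) ∷ var (∈-++⁺ˡ γ₂) ∷ vars (∈-++⁺ʳ Z ∘ there ∘ there) ⟧ˢ (++⁺ zs v)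
        ≡ All.lookup zs γ₁ ∷ All.lookup zs γ₂ ∷ x
      ⟦γξ⟧ refl =
        cong₂ _∷_ (lookup-++⁺ˡ zs _ γ₁) (cong₂ _∷_ (lookup-++⁺ˡ zs _ γ₂)
          (⟦vars⟧ _ (λ i → lookup-++⁺ʳ zs _ (there (there i)))))

    -- Translating unfoldings between a predicate and its completion.

    module _ {ξ : Ctx} {P : Pred (αβξ {ξ})} {P′ : Pred (αξ {ξ})}
             {c₁ : Const loc} {c₂ : Const dat} (completion : IsCompletion c₁ c₂ P P′) where

      module Completion {r} = Equivalence (completion {r})

      -- Supplies the end of a chain whose hole is filled with the constants.
      complete-empty : ∀ {Γ} {s : Stack Γ} {us} {x : Stack ξ} →
                       ⟦ us ⟧ˢ s ≡ ⟦ c₁ ⟧ᶜ ∷ ⟦ c₂ ⟧ᶜ ∷ x → s , emptyʰ ⊨Σ pred P′ us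
      complete-empty eq =
        fold eq (Completion.from (inj₁ refl)) [] (refl , refl) (emp⁺ λ ())

      -- The three atoms live over unrelated stacks and are linked only by their argument values:
      -- the recursion enters the contexts of two different rule bodies, while the unfolding `d′`
      -- stays in its own.
      compose : ∀ {Γ₁ Γ₂ Γ} {s₁ : Stack Γ₁} {s₂ : Stack Γ₂} {s : Stack Γ} {h h₁ h₂ ts us vs}
                  {a₁ : Loc} {a₂ : Data} {b₁ : Loc} {b₂ : Data} {x : Stack ξ} →
                SyntacticallyCompositional P →
                ⟦ ts ⟧ˢ s₁ ≡ a₁ ∷ a₂ ∷ b₁ ∷ b₂ ∷ x →
                ⟦ us ⟧ˢ s₂ ≡ b₁ ∷ b₂ ∷ x →
                ⟦ vs ⟧ˢ s  ≡ a₁ ∷ a₂ ∷ x →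
                h ≔ h₁ ⊎ʰ h₂ →
                s₁ , h₁ ⊨Σ pred P ts → s₂ , h₂ ⊨Σ pred P′ us → s , h ⊨Σ pred P′ vs
      compose compositional ts≡ us≡ vs≡ u (pred⁺ {Σ = Σ} r zs p d) d′ with hasPred? Σ
      compose compositional ts≡ us≡ vs≡ u (pred⁺ {Σ = Σ} r zs p d) d′ | no ¬hasPred
        with SyntacticallyCompositional.base-unique compositional r ¬hasPred
      compose compositional ts≡ us≡ vs≡ u (pred⁺ r [] p (emp⁺ empty)) d′ | no ¬hasPred | refl
        -- Transported along `ts≡`, the equations of the base rule identify `a₁`, `a₂` with `b₁`,
        -- `b₂`. As `h₁` is empty, `d′` is then already the unfolding sought.
        with refl , refl ← subst (_⊨ᴾ Rule.pureᴿ (baseRule {ξ})) ts≡ p =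
        ⊨Σ-resp-≗ʰ (⊎ʰ-emptyˡ⁻ u empty) (pred-cong (trans vs≡ (sym us≡)) d′)
      compose compositional ts≡ us≡ vs≡ u (pred⁺ {Σ = Σ} r zs p d) d′ | yes hasPred
        with SyntacticallyCompositional.inductive-form compositional r hasPred
      compose compositional ts≡ us≡ vs≡ u
        (pred⁺ r zs p (∗⁺ k₁ _ v d₁ (∗⁺ k₂ k₃ w d₂ d₃))) d′
        | yes hasPred | step , refl , admissible
        -- The heaps of `Σ₁` and `Σ₂` are split off in turn, which leaves the heap `k₃` of the
        -- recursive atom next to `h₂`.
        with u₁ , u₂ ← ⊎ʰ-assoc u v
        with u₂ , u₃ ← ⊎ʰ-assoc u₂ w =
        fold vs≡ (Completion.from (inj₂ (step , r , refl))) zs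
          (substᴾ⁺ Π (agree (_∈ᴾ Π) F∉Π H∉Π) (subst (λ e → ++⁺ zs e ⊨ᴾ Π) ts≡ p))
          (∗⁺ k₁ _ u₁
            (substΣ⁺ Σ₁ (agree (_∈Σ Σ₁) F∉Σ₁ H∉Σ₁) (subst (λ e → ++⁺ zs e , k₁ ⊨Σ Σ₁) ts≡ d₁))
            (∗⁺ k₂ _ u₂
              (substΣ⁺ Σ₂ (agree (_∈Σ Σ₂) F∉Σ₂ H∉Σ₂) (subst (λ e → ++⁺ zs e , k₂ ⊨Σ Σ₂) ts≡ d₂))
              (compose compositional (⟦γβξ⟧ γ₁ γ₂ zs ts≡) us≡ (⟦γξ⟧ γ₁ γ₂ zs refl) u₃ d₃ d′)))
        where
        open Step step
        open Admissible admissible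
        open Substitution (β↦c c₁ c₂ Z) (++⁺ zs _) (++⁺ zs _)
        open SubstitutionΣ (β↦c c₁ c₂ Z) (++⁺ zs _) (++⁺ zs _)

        agree : (Occurs : ∀ {σ} → σ ∈ Z ++ αβξ {ξ} → Set) →
                ¬ Occurs F → ¬ Occurs H → AgreeOn Occurs
        -- `b₁` and `b₂` may differ from the constants; admissibility makes both conditions on the
        -- hole vacuous.
        agree Occurs F∉ H∉ =
          β↦c-agrees zs Occurs (λ o → contradiction o F∉) (λ o → contradiction o H∉)

      -- Each rule of `P′` comes from a rule of `P`. Since the hole has the values of the constants,
      -- `β↦c` agrees with the stack at every variable, so the substitution can be undone with all
      -- heaps unchanged.
      uncomplete : ∀ {Γ Γ′} {s : Stack Γ} {s′ : Stack Γ′} {h vs ts}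
                     {a₁ : Loc} {a₂ : Data} {x : Stack ξ} →
                   ⟦ vs ⟧ˢ s  ≡ a₁ ∷ a₂ ∷ x →
                   ⟦ ts ⟧ˢ s′ ≡ a₁ ∷ a₂ ∷ ⟦ c₁ ⟧ᶜ ∷ ⟦ c₂ ⟧ᶜ ∷ x →
                   baseRule ∈ rules P →
                   s , h ⊨Σ pred P′ vs → s′ , h ⊨Σ pred P ts
      uncomplete vs≡ ts≡ base (pred⁺ r zs p d) with Completion.to r
      uncomplete vs≡ ts≡ base (pred⁺ r [] p (emp⁺ empty)) | inj₁ refl =
        -- With the constants as hole values, the equations of the two base rules evaluate to the
        -- same propositions.
        fold ts≡ base [] (subst (_⊨ᴾ Rule.pureᴿ (completedBase {ξ} c₁ c₂)) vs≡ p) (emp⁺ empty)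
      uncomplete vs≡ ts≡ base (pred⁺ r zs p (∗⁺ k₁ k u d₁ (∗⁺ k₂ k₃ v d₂ d₃)))
        | inj₂ (step , r′ , refl) =
        fold ts≡ r′ zs
          (substᴾ⁻ Π (agree (_∈ᴾ Π)) (subst (λ e → ++⁺ zs e ⊨ᴾ substᴾ θ Π) vs≡ p))
          (∗⁺ k₁ k u
            (substΣ⁻ Σ₁ (agree (_∈Σ Σ₁)) (subst (λ e → ++⁺ zs e , k₁ ⊨Σ substΣ θ Σ₁) vs≡ d₁))
            (∗⁺ k₂ k₃ v
              (substΣ⁻ Σ₂ (agree (_∈Σ Σ₂)) (subst (λ e → ++⁺ zs e , k₂ ⊨Σ substΣ θ Σ₂) vs≡ d₂))
              (uncomplete (⟦γξ⟧ γ₁ γ₂ zs vs≡) (⟦γβξ⟧ γ₁ γ₂ zs refl) base d₃)))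
        where
        open Step step
        θ = β↦c c₁ c₂ Z
        open Substitution θ (++⁺ zs _) (++⁺ zs _)
        open SubstitutionΣ θ (++⁺ zs _) (++⁺ zs _)

        agree : (Occurs : ∀ {σ} → σ ∈ Z ++ αβξ {ξ} → Set) → AgreeOn Occurs
        agree Occurs = β↦c-agrees zs Occurs (λ _ → refl) (λ _ → refl)

-- The equivalence and the composition entailment.

theorem2 : ⦃ S : Signature ⦄ ⦃ 𝒟 : Definitions ⦄
  (ξ : Ctx)
  (P : Pred (loc ∷ dat ∷ loc ∷ dat ∷ ξ)) (P′ : Pred (loc ∷ dat ∷ ξ))
  (c₁ : Const loc) (c₂ : Const dat) →
  SyntacticallyCompositional P →
  IsCompletion c₁ c₂ P P′ →
  (let α : Terms (loc ∷ dat ∷ ξ) (loc ∷ dat ∷ [])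
       α = var ₀ ∷ var ₁ ∷ []
       c : Terms (loc ∷ dat ∷ ξ) (loc ∷ dat ∷ [])
       c = const c₁ ∷ const c₂ ∷ []
       x : Terms (loc ∷ dat ∷ ξ) ξ
       x = vars (there ∘ there)
   in spatial (P′ ⟨ α ∣ x ⟩) ⟺ spatial (P ⟨ α ∣ c ∣ x ⟩))
  ×
  (let α : Terms (loc ∷ dat ∷ ξ) (loc ∷ dat ∷ [])
       α = var ₀ ∷ var ₁ ∷ []
       x : Terms (loc ∷ dat ∷ ξ) ξ
       x = vars (there ∘ there)
       β : Terms (loc ∷ dat ∷ loc ∷ dat ∷ ξ) (loc ∷ dat ∷ [])
       β = var ₀ ∷ var ₁ ∷ []
       α↑ : Terms (loc ∷ dat ∷ loc ∷ dat ∷ ξ) (loc ∷ dat ∷ [])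
       α↑ = var ₂ ∷ var ₃ ∷ []
       x↑ : Terms (loc ∷ dat ∷ loc ∷ dat ∷ ξ) ξ
       x↑ = vars (there ∘ there ∘ there ∘ there)
   in exists (loc ∷ dat ∷ []) (spatial (P ⟨ α↑ ∣ β ∣ x↑ ⟩ ∗ P′ ⟨ β ∣ x↑ ⟩))
        ⟹ spatial (P′ ⟨ α ∣ x ⟩))
theorem2 ξ P P′ c₁ c₂ compositional completion =
  ( (λ { (a₁ ∷ a₂ ∷ x) h → uncomplete completion (parameters a₁ a₂ x) (holes a₁ a₂ x)
                          (SyntacticallyCompositional.base-rule compositional) })
  , (λ { (a₁ ∷ a₂ ∷ x) h d →
         compose completion {us = const c₁ ∷ const c₂ ∷ vars (there ∘ there)} compositional
           (holes a₁ a₂ x) (constants a₁ a₂ x) (parameters a₁ a₂ x)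
           -- The whole heap goes to `P`, and the empty heap to the unfolding of `P′` at the
           -- constants.
           (⊎ʰ-emptyʳ h) d (complete-empty completion (constants a₁ a₂ x)) }) )
  , λ { (a₁ ∷ a₂ ∷ x) h (b₁ ∷ b₂ ∷ [] , ∗⁺ h₁ h₂ u d d′) →
        compose completion compositional
          (cong (λ y → a₁ ∷ a₂ ∷ b₁ ∷ b₂ ∷ y) (⟦vars⟧ _ (λ _ → refl)))
          (cong (λ y → b₁ ∷ b₂ ∷ y) (⟦vars⟧ _ (λ _ → refl)))
          (parameters a₁ a₂ x) u d d′ }
  where
  parameters : ∀ a₁ a₂ (x : Stack ξ) →
    ⟦ var ₀ ∷ var ₁ ∷ vars (there ∘ there) ⟧ˢ (a₁ ∷ a₂ ∷ x) ≡ a₁ ∷ a₂ ∷ x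
  parameters a₁ a₂ x = cong (λ y → a₁ ∷ a₂ ∷ y) (⟦vars⟧ _ (λ _ → refl))

  holes : ∀ a₁ a₂ (x : Stack ξ) →
    ⟦ var ₀ ∷ var ₁ ∷ const c₁ ∷ const c₂ ∷ vars (there ∘ there) ⟧ˢ (a₁ ∷ a₂ ∷ x)
      ≡ a₁ ∷ a₂ ∷ ⟦ c₁ ⟧ᶜ ∷ ⟦ c₂ ⟧ᶜ ∷ x
  holes a₁ a₂ x = cong (λ y → a₁ ∷ a₂ ∷ ⟦ c₁ ⟧ᶜ ∷ ⟦ c₂ ⟧ᶜ ∷ y) (⟦vars⟧ _ (λ _ → refl))

  constants : ∀ a₁ a₂ (x : Stack ξ) →
    ⟦ const c₁ ∷ const c₂ ∷ vars {loc ∷ dat ∷ ξ} (there ∘ there) ⟧ˢ (a₁ ∷ a₂ ∷ x) ≡ ⟦ c₁ ⟧ᶜ ∷ ⟦ c₂ ⟧ᶜ ∷ x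
  constants a₁ a₂ x = cong₂ _∷_ refl (cong₂ _∷_ refl (⟦vars⟧ x (λ _ → refl)))
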